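{- A positive integer $m$ is the sum of three octahedral numbers (that is, $m=\mathscr{O}_{a}+\mathscr{O}_{b}+\mathscr{O}_{c}$ for some integers $a,b,c\ge 1$) if and only if there is a vertex $v_{ij}$ ($i,j\ge 0$) lying in a non-trivial component of the graph $\Gamma_{\mathscr{O}}$ such that $m$ represents $v_{ij}$ in $\mathscr{R}_{\mathscr{O}}$, i.e. $m=3+4i+5j$.
   Context: The $n$-th octahedral number ($n\ge 1$) is $\mathscr{O}_{n}=\frac{n(2n^{2}+1)}{3}$. The $s$-th tetrahedral number is $\rho_{s}=\frac{s(s+1)(s+2)}{6}$, with $\rho_{0}=0$. Write $g(s)=\rho_{s}-s$ for $s\ge 0$ (so $g(0)=g(1)=0$, $g(2)=2$, $g(3)=7$). The points are symbols $v_{ij}$ indexed by pairs of integers $i,j\ge 0$ (as a poset $\mathscr{R}$, the points with fixed $j$ form the infinite chain $v_{0j}<v_{1j}<v_{2j}<\cdots$, and different chains are incomparable). In the representation $\mathscr{R}_{\mathscr{O}}$ the point $v_{ij}$ is represented by the number $n_{ij}=3+4i+5j$. The graph $\Gamma_{\mathscr{O}}$ has vertex set $\{v_{ij}: i,j\ge 0\}$, and its arrows are exactly those joining consecutive vertices of the following paths (where $v_{(x)(y)}$ denotes the vertex with first index $x$ and second index $y$): (1) the left boundary path, whose vertices in order are $v_{(g(s))(s)}$, $s=0,1,2,\dots$; (2) for all integers $i_{0},j\ge 0$, the path whose vertices in order are $v_{(g(i_{0})+g(k))(i_{0}+k)}$, $k=0,1,\dots,j$; (3) for all integers $i_{0},j\ge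 0$, the path whose vertices in order are $v_{(g(i_{0})+g(j)+g(l))(i_{0}+j+l)}$, $l=0,1,\dots,j$. A component of the graph means a connected component of the underlying undirected graph; it is non-trivial if it contains at least one arrow (i.e. it is not a single isolated vertex). -}

module Defs where

open import Level using (0ℓ)
open import Data.Nat using (ℕ; suc; _+_; _*_; _∸_; _^_; _/_; _<_)
open import Data.Product using (_×_; ∃₂)
open import Relation.Binary.Core using (Rel)
open import Relation.Binary.Construct.Closure.Equivalence using (EqClosure)
open import Relation.Binary.PropositionalEquality using (_≡_)
open import Relation.Unary using (Pred; _∈_)

-- The divisions in 𝒪 and ρ are exact: 3 ∣ n (2 n² + 1) and 6 ∣ s (s+1) (s+2).
𝒪 : ℕ → ℕ
𝒪 n = (n * (2 * n ^ 2 + 1)) / 3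

ρ : ℕ → ℕ
ρ s = (s * (s + 1) * (s + 2)) / 6

-- The subtraction never truncates, since s ≤ ρ s for every s.
g : ℕ → ℕ
g s = ρ s ∸ s

record Vertex : Set where
  constructor v
  field
    fst-index : ℕ
    snd-index : ℕ

n : Vertex → ℕ
n (v i j) = 3 + 4 * i + 5 * j

_Represents_ : ℕ → Vertex → Set
m Represents x = m ≡ n x

leftBoundary : ℕ → Vertex
leftBoundary s = v (g s) s

path₂ : (i₀ k : ℕ) → Vertex
path₂ i₀ k = v (g i₀ + g k) (i₀ + k)

path₃ : (i₀ j l : ℕ) → Vertex
path₃ i₀ j l = v (g i₀ + g j + g l) (i₀ + j + l)

-- The arrows of Γ.  The paths of the second and third family have the vertices
-- with k, l ∈ {0, …, j}, so their consecutive pairs are those starting at k, l < j.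
data _⟶_ : Rel Vertex 0ℓ where
  boundary : ∀ s → leftBoundary s ⟶ leftBoundary (suc s)
  second   : ∀ i₀ j k → k < j → path₂ i₀ k ⟶ path₂ i₀ (suc k)
  third    : ∀ i₀ j l → l < j → path₃ i₀ j l ⟶ path₃ i₀ j (suc l)

-- Reachability by undirected walks: the connected component of x.
Component : Vertex → Pred Vertex 0ℓ
Component x = EqClosure _⟶_ x

NonTrivial : Pred Vertex 0ℓ → Set
NonTrivial C = ∃₂ λ x y → x ∈ C × y ∈ C × x ⟶ y

{-# OPTIONS --safe #-}

-- Since 𝒪 (s + 1) = 1 + 4 g(s) + 5 s, the sum 𝒪 (r + 1) + 𝒪 (s + 1) + 𝒪 (t + 1)
-- is the number representing the vertex v (g(r) + g(s) + g(t)) (r + s + t).  Hence it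
-- suffices that the vertices of this shape are exactly the endpoints of arrows: every path
-- of Γ runs through such vertices only, and conversely such a vertex lies on a path of the
-- third family once s ≥ 1 and t ≤ s, and on the left boundary when s = t = 0.

module Submission where

open import Defs
open import Data.Nat using (ℕ; zero; suc; _+_; _*_; _∸_; _^_; _/_; _≤_; z≤n; s≤s)
open import Data.Nat.DivMod using (m*n/n≡m)
open import Data.Nat.Properties using (m+n∸n≡m; ≤-total; +-identityʳ)
open import Data.Nat.Tactic.RingSolver using (solve-∀)
open import Data.Product using (_×_; _,_; ∃-syntax)
open import Data.Sum using (inj₁; inj₂)
open import Function.Bundles using (_⇔_; mk⇔)
open import Relation.Binary.Construct.Closure.Equivalence using (return; symmetric)
open import Relation.Binary.Construct.Closure.ReflexiveTransitive using (ε; _◅_)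
open import Relation.Binary.Construct.Closure.Symmetric using (fwd; bwd)
open import Relation.Binary.PropositionalEquality
  using (_≡_; refl; sym; trans; cong; cong₂; subst; module ≡-Reasoning)

open ≡-Reasoning

-- δ s = s (s + 3) / 2 is the difference g (s + 1) − g s.
δ : ℕ → ℕ
δ zero    = 0
δ (suc s) = δ s + suc (suc s)

-- The same sequence as `g`, built by summing the differences `δ`: with neither division nor
-- truncated subtraction, it is open to induction and ring identities.
γ : ℕ → ℕ
γ zero    = 0
γ (suc s) = γ s + δ s

δ-closed : ∀ s → δ s * 2 ≡ s * (s + 3)
δ-closed zero    = refl
δ-closed (suc s) = begin
  (δ s + suc (suc s)) * 2        ≡⟨ expand (δ s) s ⟩
  δ s * 2 + 2 * suc (suc s)      ≡⟨ cong (_+ 2 * suc (suc s)) (δ-closed s) ⟩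
  s * (s + 3) + 2 * suc (suc s)  ≡⟨ collect s ⟩
  suc s * (suc s + 3)            ∎
  where
  expand : ∀ d s → (d + suc (suc s)) * 2 ≡ d * 2 + 2 * suc (suc s)
  expand = solve-∀
  collect : ∀ s → s * (s + 3) + 2 * suc (suc s) ≡ suc s * (suc s + 3)
  collect = solve-∀

-- Exhibits the numerator of `ρ s` as a multiple of 6, so that the division cancels and leaves
-- `ρ s = γ s + s`.
γ-closed : ∀ s → (γ s + s) * 6 ≡ s * (s + 1) * (s + 2)
γ-closed zero    = refl
γ-closed (suc s) = begin
  (γ s + δ s + suc s) * 6
    ≡⟨ expand (γ s) (δ s) s ⟩
  (γ s + s) * 6 + 3 * (δ s * 2) + 6
    ≡⟨ cong₂ (λ x y → x + 3 * y + 6) (γ-closed s) (δ-closed s) ⟩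
  s * (s + 1) * (s + 2) + 3 * (s * (s + 3)) + 6
    ≡⟨ collect s ⟩
  suc s * (suc s + 1) * (suc s + 2) ∎
  where
  expand : ∀ c d s → (c + d + suc s) * 6 ≡ (c + s) * 6 + 3 * (d * 2) + 6
  expand = solve-∀
  collect : ∀ s → s * (s + 1) * (s + 2) + 3 * (s * (s + 3)) + 6
                ≡ suc s * (suc s + 1) * (suc s + 2)
  collect = solve-∀

g≡γ : ∀ s → g s ≡ γ s
g≡γ s = begin
  s * (s + 1) * (s + 2) / 6 ∸ s  ≡⟨ cong (λ x → x / 6 ∸ s) (γ-closed s) ⟨
  (γ s + s) * 6 / 6 ∸ s          ≡⟨ cong (_∸ s) (m*n/n≡m (γ s + s) 6) ⟩
  γ s + s ∸ s                    ≡⟨ m+n∸n≡m (γ s) s ⟩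
  γ s                            ∎

𝒪-suc : ∀ s → 𝒪 (suc s) ≡ 1 + 4 * g s + 5 * s
𝒪-suc s = begin
  suc s * (2 * suc s ^ 2 + 1) / 3      ≡⟨ cong (_/ 3) cleared ⟩
  (1 + 4 * γ s + 5 * s) * 3 / 3        ≡⟨ m*n/n≡m (1 + 4 * γ s + 5 * s) 3 ⟩
  1 + 4 * γ s + 5 * s                  ≡⟨ cong (λ x → 1 + 4 * x + 5 * s) (g≡γ s) ⟨
  1 + 4 * g s + 5 * s                  ∎
  where
  -- `suc s * (suc s * 1)` is what `suc s ^ 2` unfolds to.
  expand : ∀ s → suc s * (2 * (suc s * (suc s * 1)) + 1)
               ≡ 2 * (s * (s + 1) * (s + 2)) + 3 * s + 3
  expand = solve-∀
  collect : ∀ c s → 2 * ((c + s) * 6) + 3 * s + 3 ≡ (1 + 4 * c + 5 * s) * 3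
  collect = solve-∀
  -- The numerator equals `12 * γ s + 15 * s + 3`, visibly divisible by 3.
  cleared : suc s * (2 * suc s ^ 2 + 1) ≡ (1 + 4 * γ s + 5 * s) * 3
  cleared = begin
    suc s * (2 * suc s ^ 2 + 1)                ≡⟨ expand s ⟩
    2 * (s * (s + 1) * (s + 2)) + 3 * s + 3    ≡⟨ cong (λ x → 2 * x + 3 * s + 3) (γ-closed s) ⟨
    2 * ((γ s + s) * 6) + 3 * s + 3            ≡⟨ collect (γ s) s ⟩
    (1 + 4 * γ s + 5 * s) * 3                  ∎

𝒪-sum : ∀ r s t → 𝒪 (suc r) + 𝒪 (suc s) + 𝒪 (suc t) ≡ n (path₃ r s t)
𝒪-sum r s t = begin
  𝒪 (suc r) + 𝒪 (suc s) + 𝒪 (suc t)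
    ≡⟨ cong₂ _+_ (cong₂ _+_ (𝒪-suc r) (𝒪-suc s)) (𝒪-suc t) ⟩
  (1 + 4 * g r + 5 * r) + (1 + 4 * g s + 5 * s) + (1 + 4 * g t + 5 * t)
    ≡⟨ regroup (g r) (g s) (g t) r s t ⟩
  n (path₃ r s t) ∎
  where
  regroup : ∀ x y z r s t →
    (1 + 4 * x + 5 * r) + (1 + 4 * y + 5 * s) + (1 + 4 * z + 5 * t)
      ≡ 3 + 4 * (x + y + z) + 5 * (r + s + t)
  regroup = solve-∀

path₃-zero : ∀ r s → path₃ r s 0 ≡ path₂ r s
path₃-zero r s = cong₂ v (+-identityʳ (g r + g s)) (+-identityʳ (r + s))

path₃-zero-zero : ∀ r → path₃ r 0 0 ≡ leftBoundary r
path₃-zero-zero r =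
  trans (path₃-zero r 0) (cong₂ v (+-identityʳ (g r)) (+-identityʳ r))

-- A path of the third family stops at `l = j`; this symmetry lets the smaller of two indices serve
-- as `l`.
path₃-swap : ∀ r s t → path₃ r s t ≡ path₃ r t s
path₃-swap r s t = cong₂ v (swap (g r) (g s) (g t)) (swap r s t)
  where
  swap : ∀ x y z → x + y + z ≡ x + z + y
  swap = solve-∀

-- The index `t` is not bounded by `s` here, so the condition is symmetric in all three indices.
OnPath₃ : Vertex → Set
OnPath₃ x = ∃[ r ] ∃[ s ] ∃[ t ] x ≡ path₃ r s t

on-path₂ : ∀ r s → OnPath₃ (path₂ r s)
on-path₂ r s = r , s , 0 , sym (path₃-zero r s)

on-boundary : ∀ r → OnPath₃ (leftBoundary r)
on-boundary r = r , 0 , 0 , sym (path₃-zero-zero r)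

source-on-path₃ : ∀ {x y} → x ⟶ y → OnPath₃ x
source-on-path₃ (boundary s)     = on-boundary s
source-on-path₃ (second r _ k _) = on-path₂ r k
source-on-path₃ (third r s t _)  = r , s , t , refl

target-on-path₃ : ∀ {x y} → x ⟶ y → OnPath₃ y
target-on-path₃ (boundary s)     = on-boundary (suc s)
target-on-path₃ (second r _ k _) = on-path₂ r (suc k)
target-on-path₃ (third r s t _)  = r , s , suc t , refl

-- The given arrow may lie far from `x`. If the walk from `x` to its source is empty, `x` is that
-- source; otherwise the first step of the walk is an arrow with `x` as an endpoint.
nontrivial⇒on-path₃ : ∀ x → NonTrivial (Component x) → OnPath₃ x
nontrivial⇒on-path₃ x (_ , _ , ε , _ , arrow)         = source-on-path₃ arrow
nontrivial⇒on-path₃ x (_ , _ , fwd arrow ◅ _ , _ , _) = source-on-path₃ arrow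
nontrivial⇒on-path₃ x (_ , _ , bwd arrow ◅ _ , _ , _) = target-on-path₃ arrow

source-nontrivial : ∀ {x y} → x ⟶ y → NonTrivial (Component x)
source-nontrivial arrow = _ , _ , ε , return arrow , arrow

target-nontrivial : ∀ {x y} → x ⟶ y → NonTrivial (Component y)
target-nontrivial arrow = _ , _ , symmetric _⟶_ (return arrow) , ε , arrow

ordered-path₃-nontrivial : ∀ r s t → t ≤ s → NonTrivial (Component (path₃ r s t))
-- `suc t ≤ s` is by definition `t < s`, the bound for the arrow that ends at this vertex.
ordered-path₃-nontrivial r s       (suc t) t<s = target-nontrivial (third r s t t<s)
ordered-path₃-nontrivial r (suc s) zero    _   = source-nontrivial (third r (suc s) 0 (s≤s z≤n))
-- With `j = 0` the third path is a single vertex without arrows, so the arrow comes from the left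
-- boundary.
ordered-path₃-nontrivial r zero    zero    _   =
  subst (λ x → NonTrivial (Component x)) (sym (path₃-zero-zero r))
    (source-nontrivial (boundary r))

path₃-nontrivial : ∀ r s t → NonTrivial (Component (path₃ r s t))
path₃-nontrivial r s t with ≤-total t s
... | inj₁ t≤s = ordered-path₃-nontrivial r s t t≤s
... | inj₂ s≤t = subst (λ x → NonTrivial (Component x)) (path₃-swap r t s)
                   (ordered-path₃-nontrivial r t s s≤t)

theorem13 : (m : ℕ) → 1 ≤ m →
    (∃[ a ] ∃[ b ] ∃[ c ] (1 ≤ a × 1 ≤ b × 1 ≤ c × m ≡ 𝒪 a + 𝒪 b + 𝒪 c))
    ⇔
    (∃[ i ] ∃[ j ] (NonTrivial (Component (v i j)) × m Represents (v i j)))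
theorem13 m _ = mk⇔ to from
  where
  to : ∃[ a ] ∃[ b ] ∃[ c ] (1 ≤ a × 1 ≤ b × 1 ≤ c × m ≡ 𝒪 a + 𝒪 b + 𝒪 c) →
       ∃[ i ] ∃[ j ] (NonTrivial (Component (v i j)) × m Represents (v i j))
  -- The bounds `1 ≤ a`, `1 ≤ b`, `1 ≤ c` make every index a successor, and the predecessors index
  -- the vertex.
  to (suc r , suc s , suc t , _ , _ , _ , m≡) =
    _ , _ , path₃-nontrivial r s t , trans m≡ (𝒪-sum r s t)

  from : ∃[ i ] ∃[ j ] (NonTrivial (Component (v i j)) × m Represents (v i j)) →
         ∃[ a ] ∃[ b ] ∃[ c ] (1 ≤ a × 1 ≤ b × 1 ≤ c × m ≡ 𝒪 a + 𝒪 b + 𝒪 c)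
  from (i , j , nontrivial , m≡) with nontrivial⇒on-path₃ (v i j) nontrivial
  ... | r , s , t , x≡ =
    suc r , suc s , suc t , s≤s z≤n , s≤s z≤n , s≤s z≤n ,
    trans m≡ (trans (cong n x≡) (sym (𝒪-sum r s t)))
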